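{- For every integer $q \geq 2$, the competition number of the Hamming graph $H(2,q)$ is $k(H(2,q)) = 2$.
   Context: For a positive integer $q$, let $[q]=\{1,2,\ldots,q\}$, and let $[q]^n$ be the set of $n$-tuples over $[q]$. For positive integers $n,q$, the Hamming graph $H(n,q)$ has vertex set $[q]^n$, and two vertices $x=(x_1,\ldots,x_n)$, $y=(y_1,\ldots,y_n)$ are adjacent if and only if $|\{i\in[n] \mid x_i\neq y_i\}|=1$. All graphs and digraphs are finite. The competition graph $C(D)$ of a digraph $D$ is the simple undirected graph with the same vertex set as $D$ in which two distinct vertices $u$ and $v$ are adjacent if and only if there is a vertex $x$ of $D$ such that both $(u,x)$ and $(v,x)$ are arcs of $D$. The competition number $k(G)$ of a graph $G$ is the smallest integer $k\geq 0$ such that $G$ together with $k$ additional isolated vertices is the competition graph of an acyclic digraph (a digraph with no directed cycles). -}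

module Defs where

open import Data.Empty using (⊥)
open import Data.Fin using (Fin) renaming (_≟_ to _≟ᶠ_)
open import Data.Fin.Properties using (any?; inj⇒≟; 1↔⊤; +↔⊎; *↔×)
open import Data.List using (List; []; _∷_; _++_; [_]; length; filter; allFin)
open import Data.List.Properties using (filter-≐; filter-none)
open import Data.List.Relation.Unary.All using (universal)
open import Data.List.Relation.Unary.Linked using (Linked)
open import Data.List.Relation.Unary.Unique.Propositional using (Unique)
open import Data.Nat using (ℕ; zero; suc; _+_; _^_; _≤_) renaming (_≟_ to _≟ⁿ_)
open import Data.Product using (Σ; ∃; _×_; _,_)
open import Data.Product.Function.NonDependent.Propositional using (_×-↔_)
open import Data.Sum using (_⊎_; inj₁; inj₂)
open import Data.Sum.Function.Propositional using (_⊎-↔_)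
open import Data.Unit using (tt)
open import Data.Vec using (Vec; lookup; uncons) renaming ([] to []ᵛ; _∷_ to _∷ᵛ_)
open import Function using (_∘_; _↔_; _⇔_; mk↔ₛ′; Inverse)
open import Function.Properties.Inverse using (↔-refl; ↔-sym; ↔-trans; ↔⇒↣)
open import Level using (0ℓ)
open import Relation.Binary using (Rel; Decidable; DecidableEquality; Symmetric; Irreflexive)
open import Relation.Binary.PropositionalEquality using (_≡_; _≢_; refl; sym; trans; cong; subst)
open import Relation.Nullary using (¬_; Dec; no)
open import Relation.Nullary.Decidable using (map′; ¬?; _×-dec_)

Finite : Set → Set
Finite V = ∃ λ n → V ↔ Fin n

finite⇒≟ : {V : Set} → Finite V → DecidableEquality V
finite⇒≟ (_ , V↔Fin) = inj⇒≟ (↔⇒↣ V↔Fin)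

finite⇒∃? : {V : Set} → Finite V → {P : V → Set} → (∀ x → Dec (P x)) → Dec (∃ P)
finite⇒∃? (_ , V↔Fin) {P} P? =
  map′ (λ (i , p) → from i , p)
       (λ (x , p) → to x , subst P (sym (strictlyInverseʳ x)) p)
       (any? (P? ∘ from))
  where open Inverse V↔Fin

-- Vertex sets are finite and edge (arc) relations decidable: an edge or arc
-- set is a finite subset of the set of pairs of vertices.  Loops are allowed
-- in digraphs but not in graphs.

record Graph (V : Set) : Set₁ where
  field
    finite : Finite V
    Adj    : Rel V 0ℓ
    adj?   : Decidable Adj
    symm   : Symmetric Adj
    irrefl : Irreflexive _≡_ Adj

record Digraph (V : Set) : Set₁ where
  field
    finite : Finite V
    Arc    : Rel V 0ℓ
    arc?   : Decidable Arc

open Graph using (Adj)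
open Digraph using (Arc)

infix 4 _≈_

_≈_ : {V : Set} → Graph V → Graph V → Set
G ≈ H = ∀ u v → Adj G u v ⇔ Adj H u v

-- x ∷ xs is the list of distinct vertices of the cycle, traversed in order;
-- the closing arc returns to x.  A loop is a cycle of length one (xs = []).

IsDirectedCycle : {V : Set} → Digraph V → V → List V → Set
IsDirectedCycle D x xs = Unique (x ∷ xs) × Linked (Arc D) (x ∷ xs ++ [ x ])

Acyclic : {V : Set} → Digraph V → Set
Acyclic D = ∀ x xs → ¬ IsDirectedCycle D x xs

competitionGraph : {V : Set} → Digraph V → Graph V
competitionGraph D = record
  { finite = D.finite
  ; Adj    = λ u v → u ≢ v × ∃ λ x → D.Arc u x × D.Arc v x
  ; adj?   = λ u v → ¬? (finite⇒≟ D.finite u v)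
                     ×-dec finite⇒∃? D.finite (λ x → D.arc? u x ×-dec D.arc? v x)
  ; symm   = λ (u≢v , x , ux , vx) → u≢v ∘ sym , x , vx , ux
  ; irrefl = λ u≡v (u≢v , _) → u≢v u≡v
  }
  where module D = Digraph D

infixl 6 _∪Isolated_

_∪Isolated_ : {V : Set} → Graph V → (k : ℕ) → Graph (V ⊎ Fin k)
_∪Isolated_ {V} G k = record
  { finite = let (n , V↔Fin) = G.finite in
             n + k , ↔-trans (V↔Fin ⊎-↔ ↔-refl) (↔-sym +↔⊎)
  ; Adj    = Adj′
  ; adj?   = adj′?
  ; symm   = λ {u} {v} → symm′ u v
  ; irrefl = λ {u} {v} → irrefl′ u v
  }
  where
  module G = Graph G

  Adj′ : Rel (V ⊎ Fin k) 0ℓ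
  Adj′ (inj₁ u) (inj₁ v) = G.Adj u v
  Adj′ (inj₁ _) (inj₂ _) = ⊥
  Adj′ (inj₂ _) _        = ⊥

  adj′? : Decidable Adj′
  adj′? (inj₁ u) (inj₁ v) = G.adj? u v
  adj′? (inj₁ _) (inj₂ _) = no λ ()
  adj′? (inj₂ _) _        = no λ ()

  symm′ : ∀ u v → Adj′ u v → Adj′ v u
  symm′ (inj₁ _) (inj₁ _) uv = G.symm uv

  irrefl′ : ∀ u v → u ≡ v → ¬ Adj′ u v
  irrefl′ (inj₁ _) (inj₁ _) refl uv = G.irrefl refl uv

AcyclicCompetition : {V : Set} → Graph V → ℕ → Set₁
AcyclicCompetition {V} G k =
  Σ (Digraph (V ⊎ Fin k)) λ D → Acyclic D × competitionGraph D ≈ G ∪Isolated k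

-- The competition number as a relation: the least k admitting such a digraph.

IsCompetitionNumber : {V : Set} → Graph V → ℕ → Set₁
IsCompetitionNumber G k =
  AcyclicCompetition G k × (∀ j → AcyclicCompetition G j → k ≤ j)

vec-finite : ∀ n q → Vec (Fin q) n ↔ Fin (q ^ n)
vec-finite zero    q = ↔-trans (mk↔ₛ′ (λ _ → tt) (λ _ → []ᵛ) (λ _ → refl) λ { []ᵛ → refl })
                               (↔-sym 1↔⊤)
vec-finite (suc n) q =
  ↔-trans (mk↔ₛ′ {B = Fin q × Vec (Fin q) n} uncons (λ (a , x) → a ∷ᵛ x)
                 (λ _ → refl) (λ { (_ ∷ᵛ _) → refl }))
          (↔-trans (↔-refl ×-↔ vec-finite n q) (↔-sym *↔×))

differing : ∀ {n q} → Vec (Fin q) n → Vec (Fin q) n → List (Fin n)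
differing {n} x y = filter (λ i → ¬? (lookup x i ≟ᶠ lookup y i)) (allFin n)

differing-sym : ∀ {n q} (x y : Vec (Fin q) n) → differing x y ≡ differing y x
differing-sym {n} x y = filter-≐ _ _ ((_∘ sym) , (_∘ sym)) (allFin n)

differing-refl : ∀ {n q} (x : Vec (Fin q) n) → differing x x ≡ []
differing-refl {n} x = filter-none _ (universal (λ _ i≢i → i≢i refl) (allFin n))

-- The alphabet {1,…,q} is represented by Fin q.

Hamming : (n q : ℕ) → Graph (Vec (Fin q) n)
Hamming n q = record
  { finite = q ^ n , vec-finite n q
  ; Adj    = λ x y → length (differing x y) ≡ 1
  ; adj?   = λ x y → length (differing x y) ≟ⁿ 1
  ; symm   = λ {x} {y} xy → trans (cong length (differing-sym y x)) xy
  ; irrefl = λ { {x} refl xx → 0≢1 (trans (sym (cong length (differing-refl x))) xx) }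
  }
  where
  0≢1 : 0 ≢ 1
  0≢1 ()

{-# OPTIONS --safe #-}

-- Upper bound: traverse the hook (q-1,0), …, (1,0), (0,0), (0,1), …, (0,q-1)
-- after all other vertices and before the two isolated ones.  Row a + 1 is
-- complete at (a+1,0) and may prey on (a,0); column b is complete at (0,b) and
-- may prey on (0,b+1); row 0 and column q-1 prey on the two isolated vertices.
--
-- Lower bound: a vertex (a,b) shares one prey with a row neighbour (a,d) and
-- another with a column neighbour (c,b); these differ because (a,d) and (c,b)
-- are not adjacent.  With fewer than two isolated vertices one of the two lies
-- in the Hamming graph, so every vertex of it has an arc into it, and following
-- such arcs produces a cycle.

module Submission where

open import Defs
open import Data.Empty using (⊥)
open import Data.Fin using (Fin; zero; suc; toℕ; fromℕ; inject₁; punchIn) renaming (_≟_ to _≟ᶠ_)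
open import Data.Fin.Properties
  using (injective⇒≤; punchInᵢ≢i; toℕ-injective; toℕ-inject₁; toℕ<n; toℕ≤n)
open import Data.Fin.Relation.Unary.Top using (view; ‵fromℕ; ‵inject₁)
open import Data.List using (List; []; _∷_; _++_; [_]; length; lookup; map; iterate)
open import Data.List.Membership.Propositional.Properties using (∈-∃++; ∈-++⁺ʳ; ∈-lookup)
import Data.List.Membership.DecPropositional as DecMembership
open import Data.List.Properties using (length-iterate; length-map)
open import Data.List.Relation.Unary.All as All using ([]; _∷_)
open import Data.List.Relation.Unary.All.Properties using (¬Any⇒All¬; ++⁻ˡ; ++⁻ʳ)
open import Data.List.Relation.Unary.AllPairs as AllPairs using ([]; _∷_)
open import Data.List.Relation.Unary.Any using (here)
open import Data.List.Relation.Unary.Linked as Linked using (Linked; []; [-]; _∷_)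
open import Data.List.Relation.Unary.Linked.Properties using (Linked⇒AllPairs; map⁺)
open import Data.List.Relation.Unary.Unique.Propositional using (Unique)
open import Data.Nat using (ℕ; zero; suc; _+_; _∸_; _≤_; _<_; _≤?_; z≤n; s≤s)
open import Data.Nat.Properties
  using (≤-refl; ≤-reflexive; ≤-trans; <-trans; <-irrefl; n≤1+n; 1+n≰n; m∸n≤m; m≤m+n;
         +-monoʳ-<; ∸-monoʳ-<; suc-injective)
  renaming (_≟_ to _≟ⁿ_)
open import Data.Product using (∃; _×_; _,_; proj₁; proj₂)
open import Data.Sum using (_⊎_; inj₁; inj₂)
open import Data.Sum.Properties using (inj₁-injective)
open import Data.Vec using (Vec; head) renaming ([] to []ᵛ; _∷_ to _∷ᵛ_)
open import Function using (_∘_; _on_; Equivalence; mk⇔)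
open import Function.Properties.Inverse using (↔⇒↣)
open import Function.Bundles using (Injection)
open import Level using (0ℓ)
open import Relation.Binary using (Rel; Decidable)
open import Relation.Binary.PropositionalEquality using (_≡_; _≢_; refl; sym; trans; cong; subst)
open import Relation.Nullary using (¬_; yes; no; contradiction)
open import Relation.Nullary.Decidable using (decidable-stable)

open Graph using (Adj)
open Digraph using (Arc)

-- Ranks and walks in acyclic digraphs.

-- Along a closed walk transitivity would give `rank x < rank x`, since the closing entry is `x`
-- again.
rank-increasing⇒acyclic : {V : Set} (D : Digraph V) (rank : V → ℕ) →
  (∀ {u v} → Arc D u v → rank u < rank v) → Acyclic D
rank-increasing⇒acyclic D rank increasing x xs (_ , walk) =
  <-irrefl refl (All.lookup (AllPairs.head ranks) (∈-++⁺ʳ xs (here refl)))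
  where
  ranks = Linked⇒AllPairs {R = _<_ on rank} <-trans (Linked.map increasing walk)

Unique⇒lookup-injective : {A : Set} {xs : List A} → Unique xs →
  ∀ {i j} → lookup xs i ≡ lookup xs j → i ≡ j
Unique⇒lookup-injective (_ ∷ _) {zero} {zero} _ = refl
Unique⇒lookup-injective {xs = _ ∷ xs} (x∉ ∷ _) {zero} {suc j} eq =
  contradiction eq (All.lookup x∉ (∈-lookup {xs = xs} j))
Unique⇒lookup-injective {xs = _ ∷ xs} (x∉ ∷ _) {suc i} {zero} eq =
  contradiction (sym eq) (All.lookup x∉ (∈-lookup {xs = xs} i))
Unique⇒lookup-injective (_ ∷ uniq) {suc i} {suc j} eq =
  cong suc (Unique⇒lookup-injective uniq eq)

Unique⇒length≤ : {V : Set} (fin : Finite V) {xs : List V} → Unique xs → length xs ≤ proj₁ fin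
Unique⇒length≤ (_ , V↔Fin) uniq =
  injective⇒≤ (Unique⇒lookup-injective uniq ∘ Injection.injective (↔⇒↣ V↔Fin))

Linked-prefix : {A : Set} {R : Rel A 0ℓ} {y : A} (xs : List A) {zs : List A} →
  Linked R (xs ++ y ∷ zs) → Linked R (xs ++ [ y ])
Linked-prefix []          _          = [-]
Linked-prefix (_ ∷ [])    (r ∷ _)    = r ∷ [-]
Linked-prefix (_ ∷ x ∷ xs) (r ∷ rest) = r ∷ Linked-prefix (x ∷ xs) rest

-- Supplies distinctness of the cycle cut out of a walk `y ∷ xs ++ y ∷ zs` whose tail has no
-- repetition.
Unique-rotate : {A : Set} {y : A} (xs : List A) {zs : List A} →
  Unique (xs ++ y ∷ zs) → Unique (y ∷ xs)
Unique-rotate []       _            = [] ∷ []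
Unique-rotate (x ∷ xs) (x∉ ∷ uniq) with Unique-rotate xs uniq
... | y∉ ∷ uniq′ = ((λ y≡x → All.head (++⁻ʳ xs x∉) (sym y≡x)) ∷ y∉) ∷ ++⁻ˡ xs x∉ ∷ uniq′

-- By induction the tail has no repetition, so if the head recurs in it, the stretch up to the
-- recurrence is a directed cycle.
acyclic⇒walk-unique : {V : Set} (D : Digraph V) → Acyclic D →
  ∀ {xs} → Linked (Arc D) xs → Unique xs
acyclic⇒walk-unique D acyclic {[]}     _    = []
acyclic⇒walk-unique D acyclic {x ∷ xs} walk
  with acyclic⇒walk-unique D acyclic (Linked.tail walk) | x ∈? xs
  where open DecMembership (finite⇒≟ (Digraph.finite D)) using (_∈?_)
... | uniq | no x∉xs = ¬Any⇒All¬ xs x∉xs ∷ uniq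
... | uniq | yes x∈xs with ∈-∃++ x∈xs
...   | ys , zs , refl =
  contradiction (Unique-rotate ys uniq , Linked-prefix (x ∷ ys) walk) (acyclic x ys)

iterate-linked : {A : Set} {R : Rel A 0ℓ} (f : A → A) → (∀ x → R x (f x)) →
  ∀ x n → Linked R (iterate f x n)
iterate-linked f step x zero          = []
iterate-linked f step x (suc zero)    = [-]
iterate-linked f step x (suc (suc n)) = step x ∷ iterate-linked f step (f x) (suc n)

-- Following the chosen arcs gives a walk with one entry more than `D` has vertices, so some vertex
-- repeats.
acyclic⇒no-total-arcs : {U V : Set} (D : Digraph V) → Acyclic D → (ι : U → V) → U →
  ¬ (∀ u → ∃ λ v → Arc D (ι u) (ι v))
acyclic⇒no-total-arcs D acyclic ι u₀ arcs =
  1+n≰n (subst (_≤ N) length-walk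
    (Unique⇒length≤ (Digraph.finite D) (acyclic⇒walk-unique D acyclic walk)))
  where
  N    = proj₁ (Digraph.finite D)
  next = proj₁ ∘ arcs
  us   = iterate next u₀ (suc N)

  walk : Linked (Arc D) (map ι us)
  walk = map⁺ (iterate-linked next (proj₂ ∘ arcs) u₀ (suc N))

  length-walk : length (map ι us) ≡ suc N
  length-walk = trans (length-map ι us) (length-iterate next u₀ (suc N))

-- Adjacency in the square grid.

Vertex : ℕ → Set
Vertex q = Vec (Fin q) 2

infix 5 _▪_

pattern _▪_ a b = a ∷ᵛ b ∷ᵛ []ᵛ

module _ {q : ℕ} where

  row-adjacent : ∀ (a : Fin q) {b d} → b ≢ d → Adj (Hamming 2 q) (a ▪ b) (a ▪ d)
  row-adjacent a {b} {d} b≢d with a ≟ᶠ a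
  ... | no a≢a = contradiction refl a≢a
  ... | yes _ with b ≟ᶠ d
  ...   | yes b≡d = contradiction b≡d b≢d
  ...   | no _    = refl

  column-adjacent : ∀ {a c} (b : Fin q) → a ≢ c → Adj (Hamming 2 q) (a ▪ b) (c ▪ b)
  column-adjacent {a} {c} b a≢c with a ≟ᶠ c
  ... | yes a≡c = contradiction a≡c a≢c
  ... | no _ with b ≟ᶠ b
  ...   | no b≢b = contradiction refl b≢b
  ...   | yes _  = refl

  adjacent⇒collinear : ∀ {a b c d : Fin q} → Adj (Hamming 2 q) (a ▪ b) (c ▪ d) → a ≡ c ⊎ b ≡ d
  adjacent⇒collinear {a} {b} {c} {d} adj with a ≟ᶠ c
  ... | yes a≡c = inj₁ a≡c
  ... | no _ with b ≟ᶠ d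
  ...   | yes b≡d = inj₂ b≡d

-- Lower bound.

other : ∀ {n} → Fin (2 + n) → Fin (2 + n)
other i = punchIn i zero

other≢ : ∀ {n} (i : Fin (2 + n)) → i ≢ other i
other≢ i = punchInᵢ≢i i zero ∘ sym

distinct⇒2≤ : ∀ {n} {i j : Fin n} → i ≢ j → 2 ≤ n
distinct⇒2≤ {suc zero}    {zero} {zero} i≢j = contradiction refl i≢j
distinct⇒2≤ {suc (suc _)}               _   = s≤s (s≤s z≤n)

lower-bound : ∀ n k → AcyclicCompetition (Hamming 2 (2 + n)) k → 2 ≤ k
-- Decidability of `2 ≤ k` permits the argument by contradiction.
lower-bound n k (D , acyclic , C≈H) = decidable-stable (2 ≤? k) λ 2≰k →
  acyclic⇒no-total-arcs D acyclic inj₁ (zero ▪ zero) (arc-inside 2≰k)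
  where
  common-prey : ∀ {u v} → Adj (Hamming 2 (2 + n)) u v →
    ∃ λ x → Arc D (inj₁ u) x × Arc D (inj₁ v) x
  common-prey {u} {v} adj = proj₂ (Equivalence.from (C≈H (inj₁ u) (inj₁ v)) adj)

  arc-inside : ¬ 2 ≤ k → ∀ u → ∃ λ v → Arc D (inj₁ u) (inj₁ v)
  arc-inside 2≰k (a ▪ b)
    with common-prey (row-adjacent a (other≢ b)) | common-prey (column-adjacent b (other≢ a))
  ... | inj₁ x , ux , _  | _                = x , ux
  ... | inj₂ _ , _ , _   | inj₁ y , uy , _  = y , uy
  ... | inj₂ x , _ , rx  | inj₂ y , _ , cy  = contradiction (distinct⇒2≤ x≢y) 2≰k
    where
    r≢c : inj₁ (a ▪ other b) ≢ inj₁ (other a ▪ b)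
    r≢c eq = other≢ a (cong head (inj₁-injective eq))

    x≢y : x ≢ y
    x≢y refl with adjacent⇒collinear {a = a} {other b} {other a} {b}
                    (Equivalence.to (C≈H _ _) (r≢c , inj₂ x , rx , cy))
    ... | inj₁ a≡a′ = other≢ a a≡a′
    ... | inj₂ b′≡b = other≢ b (sym b′≡b)

-- Upper bound.

module Hook (p : ℕ) where

  q = suc p

  -- Each prey determines the one line that hunts it. Row indices are compared in `ℕ` because
  -- `suc c` lies outside `Fin q`; no row hunts `fromℕ p ▪ zero`.
  Hunts : Rel (Vertex q ⊎ Fin 2) 0ℓ
  Hunts (inj₂ _)       _                       = ⊥
  Hunts (inj₁ (a ▪ b)) (inj₁ (c ▪ zero))       = toℕ a ≡ suc (toℕ c)
  Hunts (inj₁ (a ▪ b)) (inj₁ (zero ▪ suc d))   = b ≡ inject₁ d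
  Hunts (inj₁ (a ▪ b)) (inj₁ (suc _ ▪ suc _))  = ⊥
  Hunts (inj₁ (a ▪ b)) (inj₂ zero)             = a ≡ zero
  Hunts (inj₁ (a ▪ b)) (inj₂ (suc zero))       = b ≡ fromℕ p

  hunts? : Decidable Hunts
  hunts? (inj₂ _)       _                      = no λ ()
  hunts? (inj₁ (a ▪ b)) (inj₁ (c ▪ zero))      = toℕ a ≟ⁿ suc (toℕ c)
  hunts? (inj₁ (a ▪ b)) (inj₁ (zero ▪ suc d))  = b ≟ᶠ inject₁ d
  hunts? (inj₁ (a ▪ b)) (inj₁ (suc _ ▪ suc _)) = no λ ()
  hunts? (inj₁ (a ▪ b)) (inj₂ zero)            = a ≟ᶠ zero
  hunts? (inj₁ (a ▪ b)) (inj₂ (suc zero))      = b ≟ᶠ fromℕ p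

  digraph : Digraph (Vertex q ⊎ Fin 2)
  digraph = record
    { finite = Graph.finite (Hamming 2 q ∪Isolated 2)
    ; Arc    = Hunts
    ; arc?   = hunts?
    }

  -- Vertices off the hook get 0, the hook gets `1` to `p` along column 0 and `q` to `q + p` along
  -- row 0, and the isolated vertices share the top value.
  rank : Vertex q ⊎ Fin 2 → ℕ
  rank (inj₁ (zero ▪ b))      = q + toℕ b
  rank (inj₁ (suc a ▪ zero))  = p ∸ toℕ a
  rank (inj₁ (suc _ ▪ suc _)) = 0
  rank (inj₂ _)               = q + q

  -- The bound is the rank of `suc a ▪ zero`, the vertex that completes its row.
  rank-off-row-zero : ∀ a (b : Fin q) → rank (inj₁ (suc a ▪ b)) ≤ p ∸ toℕ a
  rank-off-row-zero a zero    = ≤-refl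
  rank-off-row-zero a (suc _) = z≤n

  -- The bound is the rank of `zero ▪ b`, the vertex that completes its column.
  rank≤ : ∀ (a b : Fin q) → rank (inj₁ (a ▪ b)) ≤ q + toℕ b
  rank≤ zero    b = ≤-refl
  rank≤ (suc a) b =
    ≤-trans (rank-off-row-zero a b) (≤-trans (m∸n≤m p (toℕ a)) (≤-trans (n≤1+n p) (m≤m+n q (toℕ b))))

  rank-increasing : ∀ {u v} → Hunts u v → rank u < rank v
  rank-increasing {inj₁ (suc a ▪ b)} {inj₁ (zero ▪ zero)} _ =
    s≤s (≤-trans (rank-off-row-zero a b) (≤-trans (m∸n≤m p (toℕ a)) (m≤m+n p 0)))
  rank-increasing {inj₁ (suc a ▪ b)} {inj₁ (suc c ▪ zero)} a≡c+1 =
    ≤-trans (s≤s (rank-off-row-zero a b))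
      -- Truncated subtraction is strict here because `toℕ a ≤ p`.
      (∸-monoʳ-< (≤-reflexive (sym (suc-injective a≡c+1))) (toℕ≤n a))
  rank-increasing {inj₁ (a ▪ _)} {inj₁ (zero ▪ suc d)} refl =
    ≤-trans (s≤s (rank≤ a (inject₁ d))) (+-monoʳ-< q (s≤s (≤-reflexive (toℕ-inject₁ d))))
  rank-increasing {inj₁ (a ▪ b)} {inj₂ _} _ =
    ≤-trans (s≤s (rank≤ a b)) (+-monoʳ-< q (toℕ<n b))

  -- Both predators satisfy the same equation, which fixes either the row or the column.
  common-prey⇒collinear : ∀ {a b c d : Fin q} x →
    Hunts (inj₁ (a ▪ b)) x → Hunts (inj₁ (c ▪ d)) x → a ≡ c ⊎ b ≡ d
  common-prey⇒collinear (inj₁ (_ ▪ zero))     ax cx = inj₁ (toℕ-injective (trans ax (sym cx)))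
  common-prey⇒collinear (inj₁ (zero ▪ suc _)) bx dx = inj₂ (trans bx (sym dx))
  common-prey⇒collinear (inj₂ zero)           ax cx = inj₁ (trans ax (sym cx))
  common-prey⇒collinear (inj₂ (suc zero))     bx dx = inj₂ (trans bx (sym dx))

  row-prey : ∀ a → ∃ λ x → ∀ b → Hunts (inj₁ (a ▪ b)) x
  row-prey zero    = inj₂ zero , λ _ → refl
  row-prey (suc a) = inj₁ (inject₁ a ▪ zero) , λ _ → cong suc (sym (toℕ-inject₁ a))

  column-prey : ∀ b → ∃ λ x → ∀ a → Hunts (inj₁ (a ▪ b)) x
  -- The last column has no successor on the hook and takes the second isolated vertex; any other is
  -- `inject₁ d`.
  column-prey b with view b
  ... | ‵fromℕ     = inj₂ (suc zero) , λ _ → refl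
  ... | ‵inject₁ d = inj₁ (zero ▪ suc d) , λ _ → refl

  competition : competitionGraph digraph ≈ Hamming 2 q ∪Isolated 2
  competition u v = mk⇔ (to u v) (from u v)
    where
    to : ∀ u v → Adj (competitionGraph digraph) u v → Adj (Hamming 2 q ∪Isolated 2) u v
    to (inj₂ _)       _              (_ , _ , () , _)
    to (inj₁ (_ ▪ _)) (inj₂ _)       (_ , _ , _ , ())
    to (inj₁ (a ▪ b)) (inj₁ (c ▪ d)) (u≢v , x , ux , vx) with common-prey⇒collinear x ux vx
    ... | inj₁ refl = row-adjacent a (u≢v ∘ cong (λ d → inj₁ (a ▪ d)))
    ... | inj₂ refl = column-adjacent {a = a} {c} b (u≢v ∘ cong (λ c → inj₁ (c ▪ b)))

    from : ∀ u v → Adj (Hamming 2 q ∪Isolated 2) u v → Adj (competitionGraph digraph) u v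
    from u@(inj₁ (a ▪ b)) v@(inj₁ (c ▪ d)) uv = u≢v , prey (adjacent⇒collinear uv)
      where
      u≢v : u ≢ v
      u≢v u≡v = Graph.irrefl (Hamming 2 q ∪Isolated 2) {u} {v} u≡v uv

      prey : a ≡ c ⊎ b ≡ d → ∃ λ x → Hunts u x × Hunts v x
      prey (inj₁ refl) = let x , hunts = row-prey a in x , hunts b , hunts d
      prey (inj₂ refl) = let x , hunts = column-prey b in x , hunts a , hunts c

upper-bound : ∀ p → AcyclicCompetition (Hamming 2 (suc p)) 2
upper-bound p =
    digraph
  , rank-increasing⇒acyclic digraph rank (λ {u} {v} → rank-increasing {u} {v})
  , competition
  where open Hook p

theorem4 : (q : ℕ) → 2 ≤ q → IsCompetitionNumber (Hamming 2 q) 2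
theorem4 (suc zero)    (s≤s ())
theorem4 (suc (suc n)) _ = upper-bound (suc n) , lower-bound n
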